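{- For all $n\ge 1$, $\left|\mathrm{Av}_n[\overline{14}23]\right|=C_{n-1}$, where $C_m=\frac{1}{m+1}\binom{2m}{m}$ is the $m$th Catalan number.
   Context: For $\sigma\in S_n$, the cyclic permutation $[\sigma]$ is the set of all rotations of $\sigma$; $[S_n]$ is the set of cyclic permutations of length $n$. $[\sigma]$ contains the vincular cyclic pattern $[\overline{14}23]$ if some rotation of $\sigma$ has a subsequence $xyzw$ order-isomorphic to $1423$ with $x,y$ in adjacent positions of that rotation; otherwise it avoids it. $\mathrm{Av}_n[\overline{14}23]$ is the set of $[\sigma]\in[S_n]$ avoiding $[\overline{14}23]$. -}

module Defs where

open import Data.Nat using (ℕ; suc; _<_; _/_)
open import Data.Nat.Combinatorics using (_C_)
open import Data.List using (List; _∷_; _++_; upTo)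
open import Data.List.Relation.Binary.Permutation.Propositional using (_↭_)
open import Data.Product using (Σ; ∃; _×_)
open import Relation.Binary.PropositionalEquality using (_≡_)
open import Relation.Nullary using (¬_)

-- A permutation of length n, in one-line notation, with values 0,…,n-1
-- (i.e. the usual values 1,…,n shifted down by one).
IsPerm : ℕ → List ℕ → Set
IsPerm n σ = σ ↭ upTo n

IsRotation : List ℕ → List ℕ → Set
IsRotation σ τ = Σ (List ℕ) λ a → Σ (List ℕ) λ b → (σ ≡ a ++ b) × (τ ≡ b ++ a)

-- The linear word τ contains the vincular pattern 1̅4̅23:
-- τ = a ++ x ∷ y ∷ b ++ z ∷ c ++ w ∷ d with x,y adjacent and
-- x y z w order-isomorphic to 1 4 2 3, i.e. x < z < w < y.
ContainsVinc1423 : List ℕ → Set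
ContainsVinc1423 τ =
  Σ (List ℕ) λ a → Σ (List ℕ) λ b → Σ (List ℕ) λ c → Σ (List ℕ) λ d →
  Σ ℕ λ x → Σ ℕ λ y → Σ ℕ λ z → Σ ℕ λ w →
  (τ ≡ a ++ (x ∷ y ∷ (b ++ (z ∷ (c ++ (w ∷ d)))))) ×
  (x < z) × (z < w) × (w < y)

CycAvoids : List ℕ → Set
CycAvoids σ = ∀ τ → IsRotation σ τ → ¬ ContainsVinc1423 τ

catalan : ℕ → ℕ
catalan m = ((m Data.Nat.+ m) C m) / suc m

{-# OPTIONS --safe #-}
module Submission where

-- [σ] avoids the pattern iff for every cyclic ascent x → y the values strictly between x and y,
-- read cyclically after y, decrease. Deleting the maximum preserves this, and conversely a new
-- maximum n may be inserted right after x exactly when the values above x, read after x, decrease.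
-- The admissible x are then the top k values for some k, and inserting after the j-th largest of
-- them leaves exactly j + 1 admissible places. This is the Catalan generating tree
-- (k) → (2)(3)…(k+1) with root (1), whose levels are counted by ballot numbers.

open import Defs
open import Data.Nat using (ℕ; zero; suc; _+_; _*_; _∸_; _≤_; _<_; _<?_; z≤n; s≤s; s≤s⁻¹; _≟_)
open import Data.Nat.Combinatorics using (_C_; nCk+nC[k+1]≡[n+1]C[k+1]; nCk≡nC[n∸k]; nC1≡n)
open import Data.Nat.DivMod using (m*n/n≡m; /-congˡ)
open import Data.Nat.ListAction using (sum)
open import Data.Nat.ListAction.Properties using (sum-++)
open import Data.Nat.Properties
open import Data.Nat.Tactic.RingSolver using (solve-∀)
open import Data.List using (List; []; _∷_; [_]; _++_; length; map; filter; concatMap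
                           ; upTo; initLast; _∷ʳ′_)
open import Data.List.Properties
  using (++-assoc; ++-identityʳ; ∷-injective; ∷-injectiveˡ; length-map; map-++
        ; filter-++; filter-all; filter-accept; filter-reject; upTo-∷ʳ)
open import Data.List.Membership.Propositional using (_∈_; _∉_; find; lose)
open import Data.List.Membership.Propositional.Properties using (∈-∃++; ∈-++⁺ʳ; ∈-upTo⁺)
open import Data.List.Relation.Binary.Permutation.Propositional
  using (_↭_; ↭-refl; ↭-sym; ↭-trans; ↭-reflexive; prep; swap; ↭⇒↭ₛ)
open import Data.List.Relation.Binary.Permutation.Propositional.Properties
  using (All-resp-↭; ↭-length; ∈-resp-↭; ++-comm; drop-∷; ∷↭∷ʳ; ↭-singleton-inv)
import Data.List.Relation.Binary.Permutation.Setoid.Properties as PermutationSetoid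
open import Data.List.Relation.Binary.Sublist.Propositional
  using (_⊆_; []; _∷_; _∷ʳ_; ⊆-refl; ⊆-trans; minimum; from∈; lookup)
open import Data.List.Relation.Binary.Sublist.Propositional.Properties using (++⁺; ++⁺ˡ; ++⁺ʳ)
open import Data.List.Relation.Unary.All as All using (All; []; _∷_)
import Data.List.Relation.Unary.All.Properties as AllP
open import Data.List.Relation.Unary.Any as Any using (Any; here; there)
import Data.List.Relation.Unary.Any.Properties as AnyP
open import Data.List.Relation.Unary.AllPairs as AllPairs using (AllPairs; []; _∷_)
import Data.List.Relation.Unary.AllPairs.Properties as AllPairsP
open import Data.List.Relation.Unary.Unique.Propositional using (Unique)
import Data.List.Relation.Unary.Unique.Propositional.Properties as UniqueP
open import Data.Product using (Σ; ∃; ∃₂; _×_; _,_; proj₁; proj₂)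
open import Data.Sum using (_⊎_; inj₁; inj₂)
open import Function using (_∘_)
open import Relation.Binary.PropositionalEquality
  using (_≡_; _≢_; refl; sym; trans; cong; cong₂; subst; setoid; module ≡-Reasoning)
open import Relation.Nullary using (¬_; yes; no; contradiction)
open import Relation.Unary using (Decidable)

private
  variable
    A : Set
    n x u v k l : ℕ
    a b c d σ τ ρ : List ℕ

-- Rotations of words

-- Levi's lemma for words; it compares the cuts of two successive rotations.
++-split : ∀ (as : List A) {bs} cs {ds} → as ++ bs ≡ cs ++ ds →
           (∃ λ es → cs ≡ as ++ es × bs ≡ es ++ ds) ⊎ (∃ λ es → as ≡ cs ++ es × ds ≡ es ++ bs)
++-split []       cs       eq = inj₁ (cs , refl , eq)
++-split (a ∷ as) []       eq = inj₂ (a ∷ as , refl , sym eq)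
++-split (a ∷ as) (c ∷ cs) eq with refl , eq′ ← ∷-injective eq with ++-split as cs eq′
... | inj₁ (es , refl , q) = inj₁ (es , refl , q)
... | inj₂ (es , refl , q) = inj₂ (es , refl , q)

rotate : ∀ a b → IsRotation (a ++ b) (b ++ a)
rotate a b = a , b , refl , refl

rotation-refl : IsRotation σ σ
rotation-refl {σ} = [] , σ , refl , sym (++-identityʳ σ)

rotation-sym : IsRotation σ τ → IsRotation τ σ
rotation-sym (a , b , p , q) = b , a , q , p

rotation-trans : IsRotation σ τ → IsRotation τ ρ → IsRotation σ ρ
rotation-trans (a , b , refl , refl) (c , d , eq , refl) with ++-split b c eq
... | inj₁ (e , refl , refl) = e , d ++ b , ++-assoc e d b , sym (++-assoc d b e)
... | inj₂ (e , refl , refl) = a ++ c , e , sym (++-assoc a c e) , ++-assoc e a c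

rotation⇒↭ : IsRotation σ τ → σ ↭ τ
rotation⇒↭ (a , b , refl , refl) = ++-comm a b

filter-rotation : ∀ {P : ℕ → Set} (P? : Decidable P) →
                  IsRotation σ τ → IsRotation (filter P? σ) (filter P? τ)
filter-rotation P? (a , b , refl , refl) =
  filter P? a , filter P? b , filter-++ P? a b , filter-++ P? b a

-- Viewing a rotation through its first letter reduces later proofs to asking where the cut falls
-- relative to `x` and an inserted maximum.
data HeadedRotation (x : ℕ) (c : List ℕ) (u : ℕ) (d : List ℕ) : Set where
  unmoved : x ≡ u → c ≡ d → HeadedRotation x c u d
  moved   : ∀ p q → c ≡ p ++ u ∷ q → d ≡ q ++ x ∷ p → HeadedRotation x c u d

headedRotation : IsRotation (x ∷ c) (u ∷ d) → HeadedRotation x c u d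
headedRotation {c = c} ([] , _ , refl , eq) with refl , refl ← ∷-injective eq =
  unmoved refl (sym (++-identityʳ c))
headedRotation (_ ∷ a , [] , refl , refl)    = unmoved refl (++-identityʳ a)
headedRotation (_ ∷ a , _ ∷ b , refl , refl) = moved a b refl refl

headedRotation-unique : x ∉ c → IsRotation (x ∷ c) (x ∷ d) → c ≡ d
headedRotation-unique x∉c r with headedRotation r
... | unmoved _ eq       = eq
... | moved p q refl _ = contradiction (∈-++⁺ʳ p (here refl)) x∉c

-- Two-letter sublists

⊆-drop-mid : ∀ {zs ys : List ℕ} xs → All (_≢ n) zs → zs ⊆ xs ++ n ∷ ys → zs ⊆ xs ++ ys
⊆-drop-mid []       _          (_ ∷ʳ s)   = s
⊆-drop-mid []       (z≢n ∷ _)  (refl ∷ s) = contradiction refl z≢n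
⊆-drop-mid (x ∷ xs) zs≢n       (_ ∷ʳ s)   = x ∷ʳ ⊆-drop-mid xs zs≢n s
⊆-drop-mid (x ∷ xs) (_ ∷ zs≢n) (eq ∷ s)   = eq ∷ ⊆-drop-mid xs zs≢n s

∷⊆++ : ∀ {z : ℕ} {zs} as {bs} → z ∷ zs ⊆ as ++ bs → z ∈ as ⊎ z ∷ zs ⊆ bs
∷⊆++ []       s          = inj₂ s
∷⊆++ (a ∷ as) (refl ∷ s) = inj₁ (here refl)
∷⊆++ (a ∷ as) (_ ∷ʳ s) with ∷⊆++ as s
... | inj₁ z∈as = inj₁ (there z∈as)
... | inj₂ s′   = inj₂ s′

first∈ : ∀ {z w : ℕ} → z ∷ w ∷ [] ⊆ c → z ∈ c
first∈ s = lookup s (here refl)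

second∈ : ∀ {z w : ℕ} → z ∷ w ∷ [] ⊆ c → w ∈ c
second∈ s = lookup s (there (here refl))

pair⊆ : ∀ b {c d} {z w : ℕ} → z ∷ w ∷ [] ⊆ b ++ z ∷ (c ++ w ∷ d)
pair⊆ b {c} = ++⁺ˡ b (refl ∷ ++⁺ˡ c (refl ∷ minimum _))

pair-split : ∀ {z w : ℕ} → z ∷ w ∷ [] ⊆ ρ →
             ∃ λ b → ∃ λ c → ∃ λ d → ρ ≡ b ++ z ∷ (c ++ w ∷ d)
pair-split (y ∷ʳ s) with b , c , d , refl ← pair-split s = y ∷ b , c , d , refl
pair-split (refl ∷ s) with c , d , refl ← ∈-∃++ (lookup s (here refl)) = [] , c , d , refl

-- Avoidance under insertion and deletion of the maximum

-- The part of the pattern formed by 2 and 3 is recorded as a sublist z ∷ w ∷ [] of what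
-- follows an adjacent pair x y in some rotation: rotating x to the front loses nothing.
AscentFree : List ℕ → Set
AscentFree σ = ∀ {x y c} → IsRotation σ (x ∷ y ∷ c) →
               ∀ {z w} → z ∷ w ∷ [] ⊆ c → x < z → z < w → ¬ w < y

cycAvoids⇒ascentFree : CycAvoids σ → AscentFree σ
cycAvoids⇒ascentFree av {x} {y} r {z} {w} s x<z z<w w<y with b , c , d , refl ← pair-split s =
  av _ r ([] , b , c , d , x , y , z , w , refl , x<z , z<w , w<y)

ascentFree⇒cycAvoids : AscentFree σ → CycAvoids σ
ascentFree⇒cycAvoids af _ r (a , b , c , d , x , y , z , w , refl , x<z , z<w , w<y) =
  af (rotation-trans r (rotate a (x ∷ y ∷ (b ++ z ∷ (c ++ w ∷ d)))))
     (++⁺ʳ a (pair⊆ b)) x<z z<w w<y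

ascentFree-resp : IsRotation σ τ → AscentFree σ → AscentFree τ
ascentFree-resp r af = af ∘ rotation-trans r

-- The criterion for inserting a new maximum right after `x`, where `c` is the rest of the cycle
-- read from `x`.
DecreasingAbove : ℕ → List ℕ → Set
DecreasingAbove x c = ∀ {z w} → z ∷ w ∷ [] ⊆ c → x < z → ¬ z < w

ascentFree⇒decreasing : All (_< n) c → AscentFree (x ∷ n ∷ c) → DecreasingAbove x c
ascentFree⇒decreasing c<n af s x<z z<w = af rotation-refl s x<z z<w (All.lookup c<n (second∈ s))

-- The only new adjacency runs from `x` to the letter that followed `n`, and it is harmless because
-- the values above `x` already decrease. Any other occurrence persists when `n` is put back.
ascentFree-delete : All (_< n) c → AscentFree (x ∷ n ∷ c) → AscentFree (x ∷ c)
ascentFree-delete {n} c<n af r s x<z z<w w<y with headedRotation r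
... | unmoved refl refl = ascentFree⇒decreasing c<n af (_ ∷ʳ s) x<z z<w
... | moved p []      refl refl = af (rotate (_ ∷ n ∷ p) _) (n ∷ʳ s) x<z z<w w<y
... | moved p (_ ∷ q) refl refl =
  af (rotate (_ ∷ n ∷ p) _) (⊆-trans s (++⁺ (⊆-refl {x = q}) (refl ∷ (n ∷ʳ ⊆-refl)))) x<z z<w w<y

ascentFree-insert : All (_< n) (x ∷ c) → AscentFree (x ∷ c) → DecreasingAbove x c →
                    AscentFree (x ∷ n ∷ c)
ascentFree-insert {n} {x} (x<n ∷ c<n) af dec r {z} {w} s u<z z<w w<v with headedRotation r
... | unmoved refl refl = dec s u<z z<w
-- Here `u` is `n`, so the adjacency is a descent and no value fits between.
... | moved [] _ refl eq = <-asym v<n (<-trans u<z (<-trans z<w w<v))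
  where v<n = All.head (subst (All (_< n)) (sym eq) (AllP.++⁺ c<n (x<n ∷ [])))
... | moved (_ ∷ p) [] refl refl = contra s
  where
  contra : ¬ z ∷ w ∷ [] ⊆ n ∷ p
  contra (_ ∷ʳ s′)  = af (rotate (x ∷ p) _) s′ u<z z<w w<v
  contra (refl ∷ _) = <-asym x<n (<-trans z<w w<v)
... | moved (_ ∷ p) (v ∷ q) refl refl =
  af (rotate (x ∷ p) _)
     (subst (_ ⊆_) (++-assoc q [ x ] p)
       (⊆-drop-mid (q ++ [ x ]) (<⇒≢ (<-trans z<w w<n) ∷ <⇒≢ w<n ∷ [])
         (subst (_ ⊆_) (sym (++-assoc q [ x ] (n ∷ p))) s)))
     u<z z<w w<v
  where w<n = <-trans w<v (All.head (All.tail (AllP.++⁻ʳ p c<n)))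

-- If `u` were below `x`, then `x` followed by `n` would be an increasing pair above `u`.
decreasing⇒above : DecreasingAbove x c → All (_< n) (x ∷ c) →
                   IsRotation (x ∷ n ∷ c) (u ∷ d) → DecreasingAbove u d → x ≤ u
decreasing⇒above dec (x<n ∷ c<n) r dec′ with headedRotation r
... | unmoved refl refl = ≤-refl
... | moved [] _ refl refl = <⇒≤ x<n
... | moved (_ ∷ p) q refl refl = ≮⇒≥ λ u<x → dec′ (++⁺ˡ q (refl ∷ refl ∷ minimum p)) u<x x<n

above⇒decreasing : DecreasingAbove x c → All (_< n) (x ∷ c) → x ∉ c →
                   IsRotation (x ∷ n ∷ c) (u ∷ d) → x ≤ u → DecreasingAbove u d
above⇒decreasing {x} {c} {n} {u} dec (x<n ∷ c<n) x∉c r x≤u {z} {w} s u<z z<w with headedRotation r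
... | unmoved refl refl = contra s
  where
  contra : ¬ z ∷ w ∷ [] ⊆ n ∷ c
  contra (_ ∷ʳ s′)   = dec s′ u<z z<w
  contra (refl ∷ s′) = <-asym z<w (All.lookup c<n (lookup s′ (here refl)))
... | moved [] q refl refl = <-asym u<z (All.lookup (AllP.++⁺ c<n (x<n ∷ [])) (first∈ s))
... | moved (_ ∷ p) q refl refl with ∷⊆++ q s
-- A letter after `u` in `c` and larger than `u` would form with `u` an increasing pair above `x`.
...   | inj₁ z∈q = dec (++⁺ˡ p (refl ∷ from∈ z∈q)) (≤∧≢⇒< x≤u x≢u) u<z
  where
  x≢u : x ≢ u
  x≢u refl = x∉c (∈-++⁺ʳ p (here refl))
...   | inj₂ (refl ∷ s′)        = <⇒≱ u<z x≤u
...   | inj₂ (_ ∷ʳ (refl ∷ s′)) = <-asym z<w (All.lookup (AllP.++⁻ˡ p c<n) (lookup s′ (here refl)))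
...   | inj₂ (_ ∷ʳ (_ ∷ʳ s′))   =
  dec (++⁺ʳ (u ∷ q) s′) (≤-<-trans x≤u u<z) z<w

-- Permutations and the insertion of a new maximum

perm-bounded : IsPerm n σ → All (_< n) σ
perm-bounded p = All-resp-↭ (↭-sym p) (AllP.all-upTo _)

perm-unique : IsPerm n σ → Unique σ
perm-unique p = PermutationSetoid.Unique-resp-↭ (setoid ℕ) (↭⇒↭ₛ (↭-sym p)) (UniqueP.upTo⁺ _)

perm-head∉ : IsPerm n (x ∷ c) → x ∉ c
perm-head∉ p x∈c = All.lookup (AllPairs.head (perm-unique p)) x∈c refl

upTo-suc-↭ : ∀ n → n ∷ upTo n ↭ upTo (suc n)
upTo-suc-↭ n = ↭-trans (∷↭∷ʳ n (upTo n)) (↭-reflexive (upTo-∷ʳ n))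

perm-insert : IsPerm n (x ∷ c) → IsPerm (suc n) (x ∷ n ∷ c)
perm-insert {n} p = ↭-trans (swap _ _ ↭-refl) (↭-trans (prep n p) (upTo-suc-↭ n))

perm-delete : IsPerm (suc n) (x ∷ n ∷ c) → IsPerm n (x ∷ c)
perm-delete {n} p = drop-∷ (↭-trans (swap _ _ ↭-refl) (↭-trans p (↭-sym (upTo-suc-↭ n))))

-- A relational view: matching on it exposes the cut at `x`, for which `insertAfter` has to search.
data Insertion (n x : ℕ) : List ℕ → List ℕ → Set where
  insertion : ∀ a b → Insertion n x (a ++ x ∷ b) (a ++ x ∷ n ∷ b)

insertAfter : ℕ → ℕ → List ℕ → List ℕ
insertAfter x n []      = []
insertAfter x n (y ∷ σ) with x ≟ y
... | yes _ = y ∷ n ∷ σ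
... | no  _ = y ∷ insertAfter x n σ

insertAfter-insertion : x ∈ σ → Insertion n x σ (insertAfter x n σ)
insertAfter-insertion {x} {y ∷ σ} x∈ with x ≟ y
insertAfter-insertion {σ = _ ∷ σ} x∈           | yes refl = insertion [] σ
insertAfter-insertion             (here x≡y)   | no  x≢y  = contradiction x≡y x≢y
insertAfter-insertion {x} {y ∷ σ} {n} (there x∈σ) | no _
  with σ | insertAfter x n σ | insertAfter-insertion {n = n} x∈σ
... | _ | _ | insertion a b = insertion (y ∷ a) b

insertion-perm : Insertion n x σ τ → IsPerm n σ → IsPerm (suc n) τ
insertion-perm {n} {x} (insertion a b) p =
  ↭-trans (++-comm a (x ∷ n ∷ b)) (perm-insert (↭-trans (++-comm (x ∷ b) a) p))

insertion-filter : Insertion n x σ τ → All (_< n) σ → filter (_<? n) τ ≡ σ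
insertion-filter {n} {x} (insertion a b) σ<n
  with a<n ← AllP.++⁻ˡ a σ<n | x<n ∷ b<n ← AllP.++⁻ʳ a σ<n = begin
    filter (_<? n) (a ++ x ∷ n ∷ b)                      ≡⟨ filter-++ (_<? n) a (x ∷ n ∷ b) ⟩
    filter (_<? n) a ++ filter (_<? n) (x ∷ n ∷ b)       ≡⟨ cong₂ _++_ (filter-all (_<? n) a<n) eq ⟩
    a ++ x ∷ b                                           ∎
  where
  open ≡-Reasoning
  eq : filter (_<? n) (x ∷ n ∷ b) ≡ x ∷ b
  eq = trans (filter-accept (_<? n) x<n)
         (cong (x ∷_) (trans (filter-reject (_<? n) (n≮n n)) (filter-all (_<? n) b<n)))

-- Each word contains `n` exactly once, so comparing the rotations that begin with `x n` and `v n`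
-- forces the cyclic predecessors of `n` to agree.
insertion-position : Insertion n x σ τ → Insertion n v d ρ → All (_< n) σ → All (_< n) d →
                     IsRotation τ ρ → x ≡ v
insertion-position {n} {x} {v = v} (insertion a b) (insertion a′ b′) σ<n d<n r
  with headedRotation (rotation-trans (rotation-sym (rotate a (x ∷ n ∷ b)))
                        (rotation-trans r (rotate a′ (v ∷ n ∷ b′))))
... | unmoved eq _ = eq
... | moved [] _ refl _ = contradiction (All.head (AllP.++⁻ʳ a′ d<n)) (n≮n n)
... | moved (_ ∷ p) q eq eq′ with refl , eq″ ← ∷-injective eq = contra q eq″ eq′
  where
  b++a<n : All (_< n) (b ++ a)
  b++a<n = AllP.++⁺ (All.tail (AllP.++⁻ʳ a σ<n)) (AllP.++⁻ˡ a σ<n)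
  contra : ∀ q → b ++ a ≡ p ++ v ∷ q → n ∷ b′ ++ a′ ≡ q ++ x ∷ n ∷ p → x ≡ v
  contra []      _   eq₂ with refl ← ∷-injectiveˡ eq₂ = contradiction (All.head (AllP.++⁻ʳ a σ<n)) (n≮n n)
  contra (_ ∷ q) eq₁ eq₂ with refl ← ∷-injectiveˡ eq₂ =
    contradiction (All.head (All.tail (AllP.++⁻ʳ p (subst (All (_< n)) eq₁ b++a<n)))) (n≮n n)

-- The generating tree

-- A node (d , σ) of the generating tree at level n stands for σ ∈ Sₙ into which n may be
-- inserted after x exactly when n − d ≤ x.
Node : Set
Node = ℕ × List ℕ

-- Activity is stated additively to avoid truncated subtraction; `degree≤n` makes each site `n ∸ j`
-- with `1 ≤ j ≤ degree` a genuine letter.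
record Valid (n : ℕ) (node : Node) : Set where
  constructor valid
  degree = proj₁ node
  word   = proj₂ node
  field
    degree≤n   : degree ≤ n
    perm       : IsPerm n word
    ascentFree : AscentFree word
    decreasing⇒active : IsRotation word (u ∷ c) → DecreasingAbove u c → n ≤ u + degree
    active⇒decreasing : IsRotation word (u ∷ c) → n ≤ u + degree → DecreasingAbove u c

children : ℕ → List ℕ → ℕ → List Node
children n σ zero    = []
-- The site and all larger values, including the new `n`, are active in the child: `j + 2` in all.
children n σ (suc j) = (suc (suc j) , insertAfter (n ∸ suc j) n σ) ∷ children n σ j

grow : ℕ → List Node → List Node
grow n = concatMap λ (d , σ) → children n σ d

level : ℕ → List Node
level zero    = [ 1 , [ 0 ] ]
level (suc m) = grow (suc m) (level m)

root-valid : Valid 1 (1 , [ 0 ])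
root-valid = valid ≤-refl ↭-refl free (λ {u} _ _ → m≤n+m 1 u) (λ r _ → decr r)
  where
  free : AscentFree [ 0 ]
  free r with headedRotation r
  ... | moved [] _ () _
  ... | moved (_ ∷ _) _ () _
  decr : IsRotation [ 0 ] (u ∷ c) → DecreasingAbove u c
  decr r s with headedRotation r
  decr r () | unmoved refl refl
  ... | moved [] _ () _
  ... | moved (_ ∷ _) _ () _

-- After insertion at `x` the active letters are exactly those at least `x`, by `decreasing⇒above`
-- and `above⇒decreasing`.
insertion-valid : ∀ {j} → Insertion n x σ τ → Valid n (k , σ) → x + suc j ≡ n → suc j ≤ k →
                  Valid (suc n) (suc (suc j) , τ)
insertion-valid {n} {x} {j = j} ins@(insertion a b) val x+j≡n j<d = record
  { degree≤n   = s≤s (≤-trans (m≤n+m (suc j) x) (≤-reflexive x+j≡n))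
  ; perm       = insertion-perm ins perm
  ; ascentFree = ascentFree-resp (rotation-sym τ~)
                   (ascentFree-insert c<n (ascentFree-resp σ~ ascentFree) dec)
  ; decreasing⇒active = λ {u} r dec′ →
      ≤-trans (≤-reflexive (sym x+j+1≡n+1))
      (+-monoˡ-≤ (suc (suc j))
        (decreasing⇒above dec c<n (rotation-trans (rotation-sym τ~) r) dec′))
  ; active⇒decreasing = λ {u} r n≤ →
      above⇒decreasing dec c<n (perm-head∉ perm′) (rotation-trans (rotation-sym τ~) r)
      (+-cancelʳ-≤ (suc (suc j)) x u (≤-trans (≤-reflexive x+j+1≡n+1) n≤))
  }
  where
  open Valid val
  x+j+1≡n+1 : x + suc (suc j) ≡ suc n
  x+j+1≡n+1 = trans (+-suc x (suc j)) (cong suc x+j≡n)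
  σ~ : IsRotation (a ++ x ∷ b) (x ∷ b ++ a)
  σ~ = rotate a (x ∷ b)
  τ~ : IsRotation (a ++ x ∷ n ∷ b) (x ∷ n ∷ b ++ a)
  τ~ = rotate a (x ∷ n ∷ b)
  perm′ : IsPerm n (x ∷ b ++ a)
  perm′ = ↭-trans (rotation⇒↭ (rotation-sym σ~)) perm
  c<n : All (_< n) (x ∷ b ++ a)
  c<n = perm-bounded perm′
  dec : DecreasingAbove x (b ++ a)
  dec = active⇒decreasing σ~ (≤-trans (≤-reflexive (sym x+j≡n)) (+-monoʳ-≤ x j<d))

-- Locates the inserted `n` by the distance of its site from the top; validity, distinctness and
-- recovery of the parent are all read off from this.
record ChildOf (n : ℕ) (σ : List ℕ) (j : ℕ) (node : Node) : Set where
  constructor childOf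
  field
    {site}    : ℕ
    {gap}     : ℕ
    degree≡   : proj₁ node ≡ suc (suc gap)
    site+gap  : site + suc gap ≡ n
    gap<      : gap < j
    inserted  : Insertion n site σ (proj₂ node)

children-childOf : IsPerm n σ → ∀ j → j ≤ n → All (ChildOf n σ j) (children n σ j)
children-childOf p zero    _   = []
children-childOf {n} p (suc j) j<n =
  childOf refl (m∸n+n≡m j<n) ≤-refl
    (insertAfter-insertion (∈-resp-↭ (↭-sym p) (∈-upTo⁺ (∸-monoʳ-< {n} (s≤s z≤n) j<n))))
  ∷ All.map (λ (childOf e s g i) → childOf e s (m<n⇒m<1+n g) i) (children-childOf p j (<⇒≤ j<n))

children-valid : Valid n (k , σ) → All (Valid (suc n)) (children n σ k)
children-valid val = All.map (λ { (childOf refl s g i) → insertion-valid i val s g })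
                             (children-childOf perm _ degree≤n)
  where open Valid val

grow-valid : ∀ {nodes} → All (Valid n) nodes → All (Valid (suc n)) (grow n nodes)
grow-valid []           = []
grow-valid (val ∷ vals) = AllP.++⁺ (children-valid val) (grow-valid vals)

level-valid : ∀ m → All (Valid (suc m)) (level m)
level-valid zero    = root-valid ∷ []
level-valid (suc m) = grow-valid (level-valid m)

-- Nodes of a level are pairwise inequivalent

NotRotation : Node → Node → Set
NotRotation (_ , σ) (_ , τ) = ¬ IsRotation σ τ

children-distinct : IsPerm n σ → ∀ j → j ≤ n → AllPairs NotRotation (children n σ j)
children-distinct p zero    _   = []
children-distinct {n} {σ} p (suc j) j<n with children-childOf p (suc j) j<n
... | childOf {x} refl s _ i ∷ _ =
  All.map apart (children-childOf p j (<⇒≤ j<n)) ∷ children-distinct p j (<⇒≤ j<n)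
  where
  apart : ∀ {node} → ChildOf n σ j node → ¬ IsRotation (insertAfter (n ∸ suc j) n σ) (proj₂ node)
  apart (childOf refl s′ g′ i′) r
    with refl ← insertion-position i i′ (perm-bounded p) (perm-bounded p) r =
    <⇒≢ g′ (suc-injective (+-cancelˡ-≡ x _ _ (trans s′ (sym s))))

children-filter : Valid n (k , σ) → All (λ node → filter (_<? n) (proj₂ node) ≡ σ) (children n σ k)
children-filter val = All.map (λ (childOf _ _ _ i) → insertion-filter i (perm-bounded perm))
                              (children-childOf perm _ degree≤n)
  where open Valid val

-- Erasing `n` commutes with rotation, so equivalent children would have equivalent parents.
children-apart : Valid n (k , σ) → Valid n (l , τ) → ¬ IsRotation σ τ →
                 All (λ node → All (NotRotation node) (children n τ l)) (children n σ k)
children-apart {n} vσ vτ σ≁τ =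
  All.map (λ { refl → All.map (λ { refl → σ≁τ ∘ filter-rotation (_<? n) }) (children-filter vτ) })
          (children-filter vσ)

-- Siblings are separated by their insertion sites, all other pairs by their parents.
grow-distinct : ∀ {nodes} → All (Valid n) nodes → AllPairs NotRotation nodes →
                AllPairs NotRotation (grow n nodes)
grow-distinct {n} vals dist = AllPairsP.concat⁺ (within vals) (across vals dist)
  where
  expand : Node → List Node
  expand (d , σ) = children n σ d
  within : ∀ {nodes} → All (Valid n) nodes → All (AllPairs NotRotation) (map expand nodes)
  within []           = []
  within (val ∷ vals) = children-distinct perm _ degree≤n ∷ within vals
    where open Valid val
  across : ∀ {nodes} → All (Valid n) nodes → AllPairs NotRotation nodes →
           AllPairs (λ ks ls → All (λ k → All (NotRotation k) ls) ks) (map expand nodes)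
  across []           []             = []
  across (val ∷ vals) (apart ∷ dist) =
    AllP.map⁺ (All.zipWith (λ (val′ , σ≁τ) → children-apart val val′ σ≁τ) (vals , apart))
    ∷ across vals dist

level-distinct : ∀ m → AllPairs NotRotation (level m)
level-distinct zero    = [] ∷ []
level-distinct (suc m) = grow-distinct (level-valid m) (level-distinct m)

-- Every avoider is reached

children-complete : ∀ j → x < n → n ≤ x + j →
                    Any (λ node → proj₂ node ≡ insertAfter x n σ) (children n σ j)
children-complete {x} zero    x<n n≤ = contradiction (≤-trans n≤ (≤-reflexive (+-identityʳ x))) (<⇒≱ x<n)
children-complete {x} {n} {σ} (suc j) x<n n≤ with m≤n⇒m<n∨m≡n n≤
... | inj₁ n< = there (children-complete j x<n (s≤s⁻¹ (≤-trans n< (≤-reflexive (+-suc x j)))))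
... | inj₂ eq = here (cong (λ y → insertAfter y n σ) (trans (cong (_∸ suc j) eq) (m+n∸n≡m x (suc j))))

-- The criterion puts `x` among the listed sites. Since `x` occurs only once, inserting `n` after it
-- in `σ` and in `x ∷ c` gives equivalent words.
children-reach : Valid n (k , σ) → IsPerm n (x ∷ c) → IsRotation σ (x ∷ c) → DecreasingAbove x c →
                 Any (λ node → IsRotation (proj₂ node) (x ∷ n ∷ c)) (children n σ k)
children-reach {n} {k} {σ} {x} {c} val p r dec =
  Any.map (λ { refl → reach (insertAfter-insertion x∈σ) r })
          (children-complete k x<n (decreasing⇒active r dec))
  where
  open Valid val
  x<n : x < n
  x<n = All.head (perm-bounded p)
  x∈σ : x ∈ σ
  x∈σ = ∈-resp-↭ (↭-sym (rotation⇒↭ r)) (here refl)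
  reach : ∀ {σ τ} → Insertion n x σ τ → IsRotation σ (x ∷ c) → IsRotation τ (x ∷ n ∷ c)
  reach (insertion a b) r
    with refl ← headedRotation-unique (perm-head∉ p)
                  (rotation-trans (rotation-sym r) (rotate a (x ∷ b))) = rotate a (x ∷ n ∷ b)

max-predecessor : ∀ m e → IsPerm (suc (suc m)) (suc m ∷ e) →
                  ∃₂ λ x c → IsRotation (suc m ∷ e) (x ∷ suc m ∷ c)
max-predecessor m e p with initLast e
... | c ∷ʳ′ x = x , c , rotate (suc m ∷ c) [ x ]
-- The word has at least two letters, so the maximum has a cyclic predecessor.
... | [] with () ← ↭-length p

predecessor : ∀ m → IsPerm (suc (suc m)) σ → ∃₂ λ x c → IsRotation σ (x ∷ suc m ∷ c)
predecessor m p with a , b , refl ← ∈-∃++ (∈-resp-↭ (↭-sym p) (∈-upTo⁺ (n<1+n (suc m))))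
  with x , c , r ← max-predecessor m (b ++ a) (↭-trans (++-comm (suc m ∷ b) a) p) =
  x , c , rotation-trans (rotate a (suc m ∷ b)) r

-- Rotate the maximum into second place, delete it, find the shorter word in the tree up to
-- rotation, and reinsert the maximum after the same letter.
level-complete : ∀ m → IsPerm (suc m) σ → AscentFree σ →
                 Any (λ node → IsRotation (proj₂ node) σ) (level m)
level-complete zero    p af with refl ← ↭-singleton-inv p = here rotation-refl
level-complete (suc m) p af with x , c , r ← predecessor m p =
  Any.map (λ r′ → rotation-trans r′ (rotation-sym r)) (AnyP.concatMap⁺ _ (lose node∈ (
    children-reach (All.lookup (level-valid m) node∈) p⁻ r⁻ (ascentFree⇒decreasing c<n af′))))
  where
  af′ = ascentFree-resp r af
  p⁻ = perm-delete (↭-trans (↭-sym (rotation⇒↭ r)) p)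
  c<n = All.tail (perm-bounded p⁻)
  found = find (level-complete m p⁻ (ascentFree-delete c<n af′))
  node∈ = proj₁ (proj₂ found)
  r⁻ = proj₂ (proj₂ found)

-- Counting nodes by ballot numbers

-- The number of nodes `k` generations below a node of degree `d`. Its children have degrees `2` to
-- `d + 1`; the last clause splits off the child of largest degree.
descendants : ℕ → ℕ → ℕ
descendants zero    d       = 1
descendants (suc k) zero    = 0
descendants (suc k) (suc d) = descendants k (suc (suc d)) + descendants (suc k) d

weight : ℕ → List Node → ℕ
weight k nodes = sum (map (descendants k ∘ proj₁) nodes)

weight-++ : ∀ k ms ns → weight k (ms ++ ns) ≡ weight k ms + weight k ns
weight-++ k ms ns = trans (cong sum (map-++ _ ms ns)) (sum-++ (map _ ms) (map _ ns))

children-weight : ∀ n σ k j → weight k (children n σ j) ≡ descendants (suc k) j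
children-weight n σ k zero    = refl
children-weight n σ k (suc j) = cong (descendants k (suc (suc j)) +_) (children-weight n σ k j)

grow-weight : ∀ n k nodes → weight k (grow n nodes) ≡ weight (suc k) nodes
grow-weight n k []                = refl
grow-weight n k ((d , σ) ∷ nodes) =
  trans (weight-++ k (children n σ d) (grow n nodes))
        (cong₂ _+_ (children-weight n σ k d) (grow-weight n k nodes))

-- Each step trades one level of the list for one generation of the weight, until only the root
-- remains.
level-weight : ∀ m k → weight k (level m) ≡ descendants (k + m) 1
level-weight zero    k = trans (+-identityʳ _) (cong (λ i → descendants i 1) (sym (+-identityʳ k)))
level-weight (suc m) k = trans (grow-weight (suc m) k (level m))
  (trans (level-weight m (suc k)) (cong (λ i → descendants i 1) (sym (+-suc k m))))

weight-zero : ∀ nodes → weight 0 nodes ≡ length nodes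
weight-zero []          = refl
weight-zero (_ ∷ nodes) = cong suc (weight-zero nodes)

length-level : ∀ m → length (level m) ≡ descendants m 1
length-level m = trans (sym (weight-zero (level m))) (level-weight m 0)

-- These are ballot numbers; the subtracted binomial is moved to the left.
descendants-ballot : ∀ k d →
  descendants (suc k) d + (k + k + suc d) C k ≡ (k + k + suc d) C suc k
-- A node without active sites has no descendants, and the two middle binomials agree by symmetry.
descendants-ballot k zero = trans (nCk≡nC[n∸k] k≤N) (cong (N C_) N∸k)
  where
  N = k + k + 1
  k≤N : k ≤ N
  k≤N = ≤-trans (m≤m+n k k) (m≤m+n (k + k) 1)
  N∸k : N ∸ k ≡ suc k
  N∸k = trans (cong (_∸ k) (trans (+-assoc k k 1) (cong (k +_) (+-comm k 1)))) (m+n∸m≡n k (suc k))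
descendants-ballot zero (suc d) = begin
  suc (descendants 1 d) + suc (suc d) C 0        ≡⟨ cong suc (descendants-ballot zero d) ⟩
  suc d C 0 + suc d C 1                          ≡⟨ nCk+nC[k+1]≡[n+1]C[k+1] (suc d) 0 ⟩
  suc (suc d) C 1                                ∎
  where open ≡-Reasoning
descendants-ballot (suc k) (suc d) = begin
  (f′ + f) + (K + suc (suc d)) C suc k   ≡⟨ cong (λ M → (f′ + f) + M C suc k) (+-suc K (suc d)) ⟩
  (f′ + f) + suc N C suc k               ≡⟨ cong ((f′ + f) +_) (nCk+nC[k+1]≡[n+1]C[k+1] N k) ⟨
  (f′ + f) + (N C k + N C suc k)         ≡⟨ rearrange f′ f (N C k) (N C suc k) ⟩
  (f′ + N C k) + (f + N C suc k)         ≡⟨ cong₂ _+_ ih (descendants-ballot (suc k) d) ⟩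
  N C suc k + N C suc (suc k)            ≡⟨ nCk+nC[k+1]≡[n+1]C[k+1] N (suc k) ⟩
  suc N C suc (suc k)                    ≡⟨ cong (_C suc (suc k)) (+-suc K (suc d)) ⟨
  (K + suc (suc d)) C suc (suc k)        ∎
  where
  open ≡-Reasoning
  K = suc k + suc k
  N = K + suc d
  f = descendants (suc (suc k)) d
  f′ = descendants (suc k) (suc (suc d))
  rearrange : ∀ p q r s → (p + q) + (r + s) ≡ (p + r) + (q + s)
  rearrange = solve-∀
  N≡ : ∀ k d → k + k + suc (suc (suc d)) ≡ suc k + suc k + suc d
  N≡ = solve-∀
  -- One generation fewer and a degree larger by two leave the upper index `N` unchanged, so
  -- Pascal's rule combines both hypotheses.
  ih : f′ + N C k ≡ N C suc k
  ih = subst (λ M → f′ + M C k ≡ M C suc k) (N≡ k d) (descendants-ballot k (suc (suc d)))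

-- From ballot numbers to Catalan numbers

C-absorption : ∀ n k → suc k * (suc n C suc k) ≡ suc n * (n C k)
C-absorption zero    zero    = refl
C-absorption zero    (suc k) = *-zeroʳ (suc (suc k))
C-absorption (suc n) zero    =
  trans (*-identityˡ _) (trans (nC1≡n (suc (suc n))) (sym (*-identityʳ (suc (suc n)))))
C-absorption (suc n) (suc k) = begin
  suc (suc k) * (suc (suc n) C suc (suc k))
    ≡⟨ cong (suc (suc k) *_) (nCk+nC[k+1]≡[n+1]C[k+1] (suc n) (suc k)) ⟨
  suc (suc k) * (B + suc n C suc (suc k))
    ≡⟨ *-distribˡ-+ (suc (suc k)) B _ ⟩
  (B + suc k * B) + suc (suc k) * (suc n C suc (suc k))
    ≡⟨ cong₂ (λ y z → (B + y) + z) (C-absorption n k) (C-absorption n (suc k)) ⟩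
  (B + suc n * (n C k)) + suc n * (n C suc k)
    ≡⟨ +-assoc B _ _ ⟩
  B + (suc n * (n C k) + suc n * (n C suc k))
    ≡⟨ cong (B +_) (*-distribˡ-+ (suc n) (n C k) (n C suc k)) ⟨
  B + suc n * (n C k + n C suc k)
    ≡⟨ cong (λ y → B + suc n * y) (nCk+nC[k+1]≡[n+1]C[k+1] n k) ⟩
  suc (suc n) * B                                       ∎
  where
  open ≡-Reasoning
  B = suc n C suc k

-- Adding `suc m * B` turns both sides into `suc (m + m) * B`, the left one by Pascal's rule and
-- absorption.
C-ratio : ∀ m → suc m * ((m + m) C suc m) ≡ m * ((m + m) C m)
C-ratio m = +-cancelˡ-≡ (suc m * B) _ _ (begin
  suc m * B + suc m * B′          ≡⟨ *-distribˡ-+ (suc m) B B′ ⟨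
  suc m * (B + B′)                ≡⟨ cong (suc m *_) (nCk+nC[k+1]≡[n+1]C[k+1] (m + m) m) ⟩
  suc m * (suc (m + m) C suc m)   ≡⟨ C-absorption (m + m) m ⟩
  suc (m + m) * B                 ≡⟨ *-distribʳ-+ B (suc m) m ⟩
  suc m * B + m * B               ∎)
  where
  open ≡-Reasoning
  B = (m + m) C m
  B′ = (m + m) C suc m

-- The ballot formula at degree 1 subtracts the binomial just below the middle; symmetry moves it
-- just above, as `C-ratio` requires.
descendants-reflection : ∀ m → descendants m 1 + (m + m) C suc m ≡ (m + m) C m
descendants-reflection zero    = refl
descendants-reflection (suc k) = begin
  f + M C suc (suc k)  ≡⟨ cong (f +_) symm ⟨
  f + M C k            ≡⟨ subst (λ N → f + N C k ≡ N C suc k) (M≡ k) (descendants-ballot k 1) ⟩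
  M C suc k            ∎
  where
  open ≡-Reasoning
  M = suc k + suc k
  f = descendants (suc k) 1
  M≡ : ∀ k → k + k + 2 ≡ suc k + suc k
  M≡ = solve-∀
  M≡′ : ∀ k → suc k + suc k ≡ k + suc (suc k)
  M≡′ = solve-∀
  symm : M C k ≡ M C suc (suc k)
  symm = trans (nCk≡nC[n∸k] (≤-trans (m≤m+n k (suc (suc k))) (≤-reflexive (sym (M≡′ k)))))
               (cong (M C_) (trans (cong (_∸ k) (M≡′ k)) (m+n∸m≡n k (suc (suc k)))))

-- Multiplying the reflection identity by `suc m` and applying `C-ratio` leaves `f * suc m ≡ B`, so
-- the division in `catalan` is exact.
descendants-catalan : ∀ m → descendants m 1 ≡ catalan m
descendants-catalan m = sym (trans (/-congˡ (sym f*≡B)) (m*n/n≡m f (suc m)))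
  where
  open ≡-Reasoning
  f = descendants m 1
  B = (m + m) C m
  f*≡B : f * suc m ≡ B
  f*≡B = +-cancelʳ-≡ (m * B) _ _ (begin
    f * suc m + m * B                        ≡⟨ cong₂ _+_ (*-comm f (suc m)) (sym (C-ratio m)) ⟩
    suc m * f + suc m * ((m + m) C suc m)    ≡⟨ *-distribˡ-+ (suc m) f _ ⟨
    suc m * (f + (m + m) C suc m)            ≡⟨ cong (suc m *_) (descendants-reflection m) ⟩
    B + m * B                                ∎)

theorem5p9 : (n : ℕ) → 1 ≤ n →
    Σ (List (List ℕ)) λ L →
    All (λ σ → IsPerm n σ × CycAvoids σ) L ×
    (∀ σ → IsPerm n σ → CycAvoids σ → Any (λ ρ → IsRotation ρ σ) L) ×
    AllPairs (λ ρ ρ′ → ¬ IsRotation ρ ρ′) L ×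
    length L ≡ catalan (n ∸ 1)
-- The root has length 1, so length `suc m` is found at `level m`.
theorem5p9 (suc m) _ = map proj₂ (level m)
  , AllP.map⁺ (All.map (λ val → Valid.perm val , ascentFree⇒cycAvoids (Valid.ascentFree val))
                       (level-valid m))
  , (λ σ p av → AnyP.map⁺ (level-complete m p (cycAvoids⇒ascentFree av)))
  , AllPairsP.map⁺ (level-distinct m)
  , trans (length-map proj₂ (level m)) (trans (length-level m) (descendants-catalan m))
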